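{- For every alphabet size $\sigma \geq 2$ and every Parikh vector $P \in \mathbb{N}^{\sigma}$, and for every vertex $w$ of the configuration graph $G(P)$, there exists a Hamiltonian path in $G(P)$ starting at $w$.
   Context: Alphabet $\Sigma = [\sigma]$. For $P \in \mathbb{N}^\sigma$, $n := \sum_a P[a]$ and $\Sigma^{*|_P}$ is the set of words of length $n$ over $\Sigma$ in which each symbol $a$ occurs exactly $P[a]$ times. For a word $w$ and $i\neq j$ with $w[i]\neq w[j]$, the 2-swap $w\circ(i,j)$ exchanges the symbols at positions $i$ and $j$. The configuration graph $G(P)$ has vertex set $\Sigma^{*|_P}$ and an edge $\{w,u\}$ whenever $u = w\circ(i,j)$ for some 2-swap. A Hamiltonian path starting at $w$ is a path beginning at $w$ that visits every vertex exactly once. -}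

module Defs where

open import Data.Fin using (Fin; _≟_)
open import Data.List using (List)
open import Data.List.Membership.Propositional using (_∈_)
open import Data.List.Relation.Unary.All using (All)
open import Data.List.Relation.Unary.Linked using (Linked)
open import Data.List.Relation.Unary.Unique.Propositional using (Unique)
open import Data.Nat using (ℕ)
open import Data.Product using (∃₂; _×_)
open import Data.Vec using (Vec; lookup; count; sum; _[_]≔_)
open import Relation.Binary.PropositionalEquality using (_≡_; _≢_)

Word : ℕ → ℕ → Set
Word σ n = Vec (Fin σ) n

ParikhVector : ℕ → Set
ParikhVector σ = Vec ℕ σ

-- Vertices of G(P) are the words satisfying this predicate; keeping it separate
-- from the word makes equality of vertices plain equality of words.
IsVertex : ∀ {σ} (P : ParikhVector σ) → Word σ (sum P) → Set
IsVertex P w = ∀ a → count (_≟ a) w ≡ lookup P a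

_∘⟨_,_⟩ : ∀ {σ n} → Word σ n → Fin n → Fin n → Word σ n
w ∘⟨ i , j ⟩ = (w [ i ]≔ lookup w j) [ j ]≔ lookup w i

-- This relation is symmetric (the same i and j swap back), so it presents the
-- undirected edges {w , u}.
Edge : ∀ {σ n} → Word σ n → Word σ n → Set
Edge w u = ∃₂ λ i j → i ≢ j × lookup w i ≢ lookup w j × u ≡ w ∘⟨ i , j ⟩

record IsHamiltonianPath {σ} (P : ParikhVector σ) (ws : List (Word σ (sum P))) : Set where
  field
    vertices : All (IsVertex P) ws
    edges    : Linked Edge ws
    distinct : Unique ws
    covers   : ∀ u → IsVertex P u → u ∈ ws

{-# OPTIONS --safe #-}

-- Since a path may start anywhere, its endpoint is irrelevant.  By induction on
-- the length, the words with a fixed first letter a can be traversed from any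
-- of them.  Wherever this traversal ends, any other letter b of the word still
-- occurs behind a, so swapping it to the front enters the block of words that
-- begin with b.  Visiting the blocks of all occurring letters one after another
-- gives a Hamiltonian path.

module Submission where

open import Defs
open import Data.Bool using (true; false)
open import Data.Fin using (Fin; zero; suc; _≟_)
open import Data.List using (List; []; _∷_; _++_; map; last; filter; allFin)
open import Data.List.Membership.Propositional using (_∈_)
open import Data.List.Membership.Propositional.Properties using (∈-++⁺ˡ; ∈-++⁺ʳ; ∈-map⁺; ∈-filter⁺; ∈-allFin)
open import Data.List.Properties using (last-map)
open import Data.List.Relation.Unary.All as All using (All; []; _∷_)
import Data.List.Relation.Unary.All.Properties as All
open import Data.List.Relation.Unary.AllPairs using ([]; _∷_)
open import Data.List.Relation.Unary.Any using (here; there)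
open import Data.List.Relation.Unary.Linked as Linked using (Linked; [-])
import Data.List.Relation.Unary.Linked.Properties as Linked
open import Data.List.Relation.Unary.Unique.Propositional using (Unique)
import Data.List.Relation.Unary.Unique.Propositional.Properties as Unique
open import Data.Maybe as Maybe using (just)
open import Data.Maybe.Relation.Binary.Connected using (Connected; just)
open import Data.Nat using (ℕ; suc; _≤_; _<_; _<?_; z<s)
open import Data.Nat.Properties using (suc-injective)
open import Data.Product using (∃; _×_; _,_; proj₁; proj₂)
open import Data.Sum using (inj₁; inj₂; [_,_]′)
open import Data.Vec using (Vec; []; _∷_; sum; count; head; lookup; _[_]≔_)
open import Data.Vec.Properties using (∷-injectiveʳ)
open import Function using (_∘_)
open import Level using (0ℓ)
open import Relation.Binary.Core using (Rel)
open import Relation.Binary.PropositionalEquality using (_≡_; _≢_; refl; sym; trans; cong; subst)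
open import Relation.Nullary using (does; yes; no; contradiction)
open import Relation.Nullary.Decidable using (¬?; _×-dec_; dec-true)
open import Relation.Unary using (Pred; Decidable; _∪_; _⊥_; _≐_)

-- A Hamiltonian path of the graph that `R` induces on `Q`. Leaving `Q` free lets one notion serve a
-- single block, a union of blocks and a whole class of rearrangements.
record Traverses {A : Set} (R : Rel A 0ℓ) (Q : Pred A 0ℓ) (xs : List A) : Set where
  field
    sound    : All Q xs
    edges    : Linked R xs
    distinct : Unique xs
    covers   : ∀ {x} → Q x → x ∈ xs

open Traverses

module _ {A : Set} {R : Rel A 0ℓ} where

  Traverses-resp-≐ : ∀ {Q Q′ : Pred A 0ℓ} {xs} → Q ≐ Q′ → Traverses R Q xs → Traverses R Q′ xs
  Traverses-resp-≐ (to , from) t = record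
    { sound    = All.map to (sound t)
    ; edges    = edges t
    ; distinct = distinct t
    ; covers   = covers t ∘ from
    }

  Traverses-++ : ∀ {Q Q′ : Pred A 0ℓ} {xs x y ys} → Q ⊥ Q′ → last xs ≡ just x → R x y →
                 Traverses R Q xs → Traverses R Q′ (y ∷ ys) → Traverses R (Q ∪ Q′) (xs ++ y ∷ ys)
  Traverses-++ {xs = xs} {y = y} disj last≡x Rxy t t′ = record
    { sound    = All.++⁺ (All.map inj₁ (sound t)) (All.map inj₂ (sound t′))
    ; edges    = Linked.++⁺ (edges t)
                   (subst (λ m → Connected R m (just y)) (sym last≡x) (just Rxy)) (edges t′)
    ; distinct = Unique.++⁺ (distinct t) (distinct t′)
                   (λ (z∈xs , z∈ys) → disj (All.lookup (sound t) z∈xs , All.lookup (sound t′) z∈ys))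
    ; covers   = [ ∈-++⁺ˡ ∘ covers t , ∈-++⁺ʳ xs ∘ covers t′ ]′
    }

-- The membership is what lets the soundness of a traversal be applied to its endpoint.
last-∷ : ∀ {A : Set} (x : A) xs → ∃ λ y → last (x ∷ xs) ≡ just y × y ∈ x ∷ xs
last-∷ x []       = x , refl , here refl
last-∷ x (y ∷ xs) with last-∷ y xs
... | z , eq , z∈ = z , eq , there z∈

module _ {A : Set} {P : Pred A 0ℓ} (P? : Decidable P) where

  count-∷-cong : ∀ {m n} x (u : Vec A m) (v : Vec A n) →
                 count P? u ≡ count P? v → count P? (x ∷ u) ≡ count P? (x ∷ v)
  count-∷-cong x _ _ eq with does (P? x)
  ... | true  = cong suc eq
  ... | false = eq

  count-∷-cancel : ∀ {m n} x (u : Vec A m) (v : Vec A n) →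
                   count P? (x ∷ u) ≡ count P? (x ∷ v) → count P? u ≡ count P? v
  count-∷-cancel x _ _ eq with does (P? x)
  ... | true  = suc-injective eq
  ... | false = eq

  count-∷-comm : ∀ {n} x y (v : Vec A n) → count P? (x ∷ y ∷ v) ≡ count P? (y ∷ x ∷ v)
  count-∷-comm x y v with does (P? x) | does (P? y)
  ... | true  | true  = refl
  ... | true  | false = refl
  ... | false | true  = refl
  ... | false | false = refl

  -- Both sides list the same letters. Past the first position, `y` is commuted to the front, the
  -- induction hypothesis is applied behind it, and `y` is commuted back behind `x`.
  count-exchange : ∀ {n} x (v : Vec A n) j →
                   count P? (lookup v j ∷ v [ j ]≔ x) ≡ count P? (x ∷ v)
  count-exchange x (y ∷ v) zero    = count-∷-comm y x v
  count-exchange x (y ∷ v) (suc j) =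
    trans (count-∷-comm (lookup v j) y (v [ j ]≔ x))
      (trans (count-∷-cong y (lookup v j ∷ v [ j ]≔ x) (x ∷ v) (count-exchange x v j)) (count-∷-comm y x v))

  count>0⇒lookup : ∀ {n} (v : Vec A n) → 0 < count P? v → ∃ λ j → P (lookup v j)
  count>0⇒lookup (x ∷ v) pos with P? x
  ... | yes px = zero , px
  ... | no  _  with count>0⇒lookup v pos
  ...   | j , p = suc j , p

  count>0-head : ∀ {n x} (v : Vec A n) → P x → 0 < count P? (x ∷ v)
  count>0-head {x = x} v px rewrite dec-true (P? x) px = z<s

-- A record, so that both words can be inferred from a proof of u ∼ w.
record _∼_ {σ n} (u w : Word σ n) : Set where
  constructor mk∼
  field
    count≡ : ∀ a → count (_≟ a) u ≡ count (_≟ a) w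

open _∼_

∼-refl : ∀ {σ n} {w : Word σ n} → w ∼ w
∼-refl = mk∼ λ _ → refl

∼-sym : ∀ {σ n} {u w : Word σ n} → u ∼ w → w ∼ u
∼-sym u∼w = mk∼ λ a → sym (count≡ u∼w a)

∼-trans : ∀ {σ n} {u v w : Word σ n} → u ∼ v → v ∼ w → u ∼ w
∼-trans u∼v v∼w = mk∼ λ a → trans (count≡ u∼v a) (count≡ v∼w a)

∼-∷ : ∀ {σ n} a {u w : Word σ n} → u ∼ w → (a ∷ u) ∼ (a ∷ w)
∼-∷ a {u} {w} u∼w = mk∼ λ c → count-∷-cong (_≟ c) a u w (count≡ u∼w c)

∼-tail : ∀ {σ n a} {u w : Word σ n} → (a ∷ u) ∼ (a ∷ w) → u ∼ w
∼-tail {a = a} {u} {w} au∼aw = mk∼ λ c → count-∷-cancel (_≟ c) a u w (count≡ au∼aw c)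

∼-exchange : ∀ {σ n} a (v : Word σ n) j → (lookup v j ∷ v [ j ]≔ a) ∼ (a ∷ v)
∼-exchange a v j = mk∼ λ c → count-exchange (_≟ c) a v j

exchange-edge : ∀ {σ n a} {v : Word σ n} j → a ≢ lookup v j → Edge (a ∷ v) (lookup v j ∷ v [ j ]≔ a)
exchange-edge j a≢ = zero , suc j , (λ ()) , a≢ , refl

Edge-∷ : ∀ {σ n} a {u v : Word σ n} → Edge u v → Edge (a ∷ u) (a ∷ v)
Edge-∷ a (i , j , i≢j , ui≢uj , refl) = suc i , suc j , (λ { refl → i≢j refl }) , ui≢uj , refl

Block : ∀ {σ n} → Word σ (suc n) → List (Fin σ) → Pred (Word σ (suc n)) 0ℓ
Block w as u = u ∼ w × head u ∈ as

module _ {σ n} {w : Word σ (suc n)} where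

  -- Prefixing `a` is injective and preserves edges. For coverage, cancelling the common first
  -- letter turns a word of the block into a rearrangement of `v`.
  Traverses-block : ∀ {a} {v : Word σ n} {vs} → (a ∷ v) ∼ w →
                    Traverses Edge (_∼ v) vs → Traverses Edge (Block w (a ∷ [])) (map (a ∷_) vs)
  Traverses-block {a} {v} av∼w t = record
    { sound    = All.map⁺ (All.map (λ u∼v → ∼-trans (∼-∷ a u∼v) av∼w , here refl) (sound t))
    ; edges    = Linked.map⁺ (Linked.map (Edge-∷ a) (edges t))
    ; distinct = Unique.map⁺ ∷-injectiveʳ (distinct t)
    ; covers   = λ { {_ ∷ u} (u∼w , here refl) →
                   ∈-map⁺ (a ∷_) (covers t (∼-tail (∼-trans u∼w (∼-sym av∼w)))) }
    }

  Block-⊥ : ∀ {a bs} → All (a ≢_) bs → Block w (a ∷ []) ⊥ Block w bs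
  Block-⊥ a∉bs ((_ , here refl) , (_ , a∈bs)) = All.lookup a∉bs a∈bs refl

  Block-∷ : ∀ {a bs} → (Block w (a ∷ []) ∪ Block w bs) ≐ Block w (a ∷ bs)
  Block-∷ = (λ { (inj₁ (u∼w , here eq)) → u∼w , here eq ; (inj₂ (u∼w , u∈bs)) → u∼w , there u∈bs })
          , (λ { (u∼w , here eq) → inj₁ (u∼w , here eq) ; (u∼w , there u∈bs) → inj₂ (u∼w , u∈bs) })

  -- As `b` occurs in `w`, it occurs in the rearrangement `a ∷ v`, and not at the front because
  -- `a ≢ b`. Exchanging it with the front letter is then a 2-swap.
  enter-block : ∀ {a b v} → (a ∷ v) ∼ w → a ≢ b → 0 < count (_≟ b) w →
                ∃ λ v′ → (b ∷ v′) ∼ w × Edge (a ∷ v) (b ∷ v′)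
  enter-block {a} {b} {v} av∼w a≢b pos
    with count>0⇒lookup (_≟ b) (a ∷ v) (subst (0 <_) (sym (count≡ av∼w b)) pos)
  ... | zero  , a≡b  = contradiction a≡b a≢b
  ... | suc j , refl =
    v [ j ]≔ a , ∼-trans (∼-exchange a v j) av∼w , exchange-edge j a≢b

  -- Induction on the letters still to be visited. `rec` must accept every starting word, since the
  -- tail `v′` with which the next block is entered depends on where the previous traversal ended.
  traverse-blocks : (∀ (v : Word σ n) → ∃ λ vs → Traverses Edge (_∼ v) (v ∷ vs)) →
                    ∀ {bs a v} → Unique (a ∷ bs) → All (λ b → 0 < count (_≟ b) w) bs → (a ∷ v) ∼ w →
                    ∃ λ ws → Traverses Edge (Block w (a ∷ bs)) ((a ∷ v) ∷ ws)
  traverse-blocks rec {[]} {a} {v} _ _ av∼w with rec v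
  ... | vs , t = map (a ∷_) vs , Traverses-block av∼w t
  traverse-blocks rec {b ∷ bs} {a} {v} (a∉@(a≢b ∷ _) ∷ bs!) (b>0 ∷ bs>0) av∼w
    with rec v
  ... | vs , t with last-∷ v vs
  ...   | l , last≡l , l∈
    -- The endpoint `a ∷ l` lies on the traversal of its block, so by soundness it is still a
    -- rearrangement of `w`.
    with enter-block (proj₁ (All.lookup (sound (Traverses-block av∼w t)) (∈-map⁺ (a ∷_) l∈))) a≢b b>0
  ...     | v′ , bv′∼w , edge with traverse-blocks rec bs! bs>0 bv′∼w
  ...       | ws , t′ = map (a ∷_) vs ++ (b ∷ v′) ∷ ws , Traverses-resp-≐ Block-∷
    (Traverses-++ (Block-⊥ a∉) (trans (last-map (a ∷_) (v ∷ vs)) (cong (Maybe.map (a ∷_)) last≡l))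
      edge (Traverses-block av∼w t) t′)

traverse-∼ : ∀ {σ n} (w : Word σ n) → ∃ λ ws → Traverses Edge (_∼ w) (w ∷ ws)
traverse-∼ [] = [] , record
  { sound    = ∼-refl ∷ []
  ; edges    = [-]
  ; distinct = [] ∷ []
  ; covers   = λ { {[]} _ → here refl }
  }
traverse-∼ {σ} w@(a ∷ v) =
  -- The recursion is on the length: `traverse-∼` is passed on for all words of the length of `v`,
  -- not for `v` alone.
  let ws , t = traverse-blocks traverse-∼ (a∉others ∷ Unique.filter⁺ other? (Unique.allFin⁺ σ))
                 (All.map proj₁ (All.all-filter other? (allFin σ))) ∼-refl
  in ws , Traverses-resp-≐ (proj₁ , λ u∼w → u∼w , head∈ u∼w) t
  where
  -- Occurrence in `w` makes a block enterable; excluding `a` keeps the letters distinct once `a` is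
  -- put first.
  other? : Decidable (λ b → 0 < count (_≟ b) w × a ≢ b)
  other? b = (0 <? count (_≟ b) w) ×-dec ¬? (a ≟ b)

  a∉others : All (a ≢_) (filter other? (allFin σ))
  a∉others = All.map proj₂ (All.all-filter other? (allFin σ))

  -- The first letter of `u` occurs in `u`, hence in `w`, so it is `a` or passes the filter. Thus
  -- the blocks exhaust the class of `w`.
  head∈ : ∀ {u} → u ∼ w → head u ∈ a ∷ filter other? (allFin σ)
  head∈ {b ∷ u} u∼w with a ≟ b
  ... | yes a≡b = here (sym a≡b)
  ... | no  a≢b = there (∈-filter⁺ other? (∈-allFin b)
    (subst (0 <_) (count≡ u∼w b) (count>0-head (_≟ b) u refl) , a≢b))

theorem4 : (σ : ℕ) → 2 ≤ σ → (P : ParikhVector σ) → (w : Word σ (sum P)) → IsVertex P w → ∃ λ ws → IsHamiltonianPath P (w ∷ ws)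
theorem4 σ _ P w w∈P with traverse-∼ w
-- Since `w` has Parikh vector `P`, the vertices are exactly the rearrangements of `w`.
... | ws , t = ws , record
  { vertices = All.map (λ u∼w a → trans (count≡ u∼w a) (w∈P a)) (sound t)
  ; edges    = edges t
  ; distinct = distinct t
  ; covers   = λ u u∈P → covers t (mk∼ λ a → trans (u∈P a) (sym (w∈P a)))
  }
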